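{- Let $\mathbf{x}$ be a Sturmian word. Then the maximum gap between consecutive positions at which cubes end in $\mathbf{x}$ is at most $10$. Moreover, this bound is optimal: there exists a Sturmian word for which the maximum gap between consecutive ending positions of cubes is exactly $10$.
   Context: Words. For a finite word $w = w[0..n-1]$ of length $n\ge 1$, a positive integer $p \le n$ is a period of $w$ if $w[i]=w[i+p]$ for all $i\in\{0,\ldots,n-p-1\}$; the smallest period is denoted $\mathrm{per}(w)$. For a real number $e\ge 1$, $w$ is an $e$-power if $\lceil e\cdot \mathrm{per}(w)\rceil = |w|$, where $|w|$ is the length of $w$. A cube is a $3$-power. A factor of a word is a block of consecutive letters occurring in it. Sturmian words. A Sturmian word is a (right-)infinite word $\mathbf{x}=\mathbf{x}[0]\mathbf{x}[1]\mathbf{x}[2]\cdots$ over $\{0,1\}$ having exactly $n+1$ distinct factors of length $n$ for every $n\ge 0$ (equivalently, an infinite aperiodic binary balanced word). Gaps. A cube ends at position $n$ in $\mathbf{x}$ if there is $m$ with $1\le m\le n$ such that the factor $\mathbf{x}[n-m]\cdots\mathbf{x}[n-1]$ is a cube. Let $p_1<p_2<\cdots$ be the list of all positions at which some cube ends in $\mathbf{x}$. "The maximum gap is at most $G$" means that this list is infinite and $p_{i+1}-p_i\le G$ for all $i\ge 1$; the maximum gap is $\max_i (p_{i+1}-p_i)$. -}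

module Defs where

open import Data.Fin using (Fin; toℕ)
open import Data.Nat using (ℕ; suc; _+_; _*_; _∸_; _≤_; _<_)
open import Data.Product using (_×_; ∃-syntax)
open import Data.Vec using (Vec; lookup; tabulate)
open import Data.Vec.Membership.Propositional using (_∈_)
open import Data.Vec.Relation.Unary.Unique.Propositional using (Unique)
open import Function using (_⇔_)
open import Relation.Binary.PropositionalEquality using (_≡_)

Word : ℕ → Set
Word n = Vec (Fin 2) n

InfiniteWord : Set
InfiniteWord = ℕ → Fin 2

IsPeriod : ∀ {n} → Word n → ℕ → Set
IsPeriod {n} w p =
  1 ≤ p × p ≤ n × (∀ (i j : Fin n) → toℕ j ≡ toℕ i + p → lookup w i ≡ lookup w j)

IsSmallestPeriod : ∀ {n} → Word n → ℕ → Set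
IsSmallestPeriod w p = IsPeriod w p × (∀ q → IsPeriod w q → p ≤ q)

-- For an integer exponent e the condition ⌈ e · per w ⌉ = ∣ w ∣ needs no
-- ceiling.  Since per w is the smallest period, 000000 is a 6-power and not a
-- 3-power.
IsPower : ℕ → ∀ {n} → Word n → Set
IsPower e {n} w = ∃[ p ] IsSmallestPeriod w p × e * p ≡ n

IsCube : ∀ {n} → Word n → Set
IsCube = IsPower 3

-- x[i] x[i+1] ⋯ x[i+n-1]
block : InfiniteWord → ℕ → (n : ℕ) → Word n
block x i n = tabulate λ k → x (i + toℕ k)

IsFactor : InfiniteWord → ∀ {n} → Word n → Set
IsFactor x {n} w = ∃[ i ] block x i n ≡ w

HasExactly : ℕ → {A : Set} → (A → Set) → Set
HasExactly k {A} P = ∃[ as ] Unique {n = k} as × (∀ (a : A) → a ∈ as ⇔ P a)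

Sturmian : InfiniteWord → Set
Sturmian x = ∀ n → HasExactly (suc n) (IsFactor x {n})

CubeEndsAt : InfiniteWord → ℕ → Set
CubeEndsAt x n = ∃[ m ] 1 ≤ m × m ≤ n × IsCube (block x (n ∸ m) m)

-- P holds infinitely often, and p 0 < p 1 < ⋯ lists all positions where it
-- does (indexed from 0).
Lists : (ℕ → ℕ) → (ℕ → Set) → Set
Lists p P = (∀ i → p i < p (suc i)) × (∀ n → P n ⇔ (∃[ i ] p i ≡ n))

-- The subtraction never truncates, because p is increasing.
gap : (ℕ → ℕ) → ℕ → ℕ
gap p i = p (suc i) ∸ p i

MaxCubeGapAtMost : InfiniteWord → ℕ → Set
MaxCubeGapAtMost x G = ∃[ p ] Lists p (CubeEndsAt x) × (∀ i → gap p i ≤ G)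

MaxCubeGapIs : InfiniteWord → ℕ → Set
MaxCubeGapIs x G =
  ∃[ p ] Lists p (CubeEndsAt x) × (∀ i → gap p i ≤ G) × (∃[ i ] gap p i ≡ G)

{-# OPTIONS --safe #-}

-- A Sturmian word is balanced: a shortest unbalanced pair of factors has the form
-- 0w0, 1w1 with w a palindrome, and having only one right special factor of each
-- length then forces eventual periodicity.  Every balanced word of length 17 has a
-- cube ending at one of its last 10 positions, which is a small search over left
-- extensions; positions too near the start of x for such a window need the cube that
-- is already there.  The bound is attained by the characteristic word of slope √2 - 1,
-- with cubes ending at 17 and 27 but nowhere in between; it is Sturmian because
-- it is balanced and, by Pell approximations of √2 from both sides, each of its
-- prefixes occurs preceded by 0 and preceded by 1.
module Submission where

open import Defs
open import Data.Bool using (Bool; true; false; not; if_then_else_; _∧_; _∨_; T; T?)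
open import Data.Bool.ListAction using (any)
open import Data.Bool.Properties using (T-∧; T-∨; T-not-≡)
open import Data.Empty using (⊥; ⊥-elim)
open import Data.Fin using (Fin; zero; suc; toℕ; fromℕ<)
open import Data.Fin.Properties
  using (toℕ<n; toℕ-fromℕ<; toℕ-injective; pigeonhole; any?; _≟_; fromℕ<-injective)
open import Data.List using (List; []; _∷_; length; drop; upTo)
open import Data.List.Properties using (length-drop)
open import Data.List.Relation.Unary.Any using (satisfied)
open import Data.List.Relation.Unary.Any.Properties using (any⁻)
open import Data.Nat
  using (ℕ; zero; suc; _+_; _*_; _∸_; _≤_; _<_; _≤ᵇ_; _<ᵇ_; z≤n; s≤s; z<s; s<s; s≤s⁻¹; s<s⁻¹)
open import Data.Nat.Divisibility using (divides)
open import Data.Nat.Induction using (<-rec)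
open import Data.Nat.Primality using (euclidsLemma; prime[2])
open import Data.Nat.Properties hiding (_≟_)
open import Data.Nat.Tactic.RingSolver using (solve-∀)
open import Data.Product using (_×_; _,_; proj₁; proj₂; ∃-syntax; Σ-syntax)
open import Data.Sum using (_⊎_; inj₁; inj₂)
open import Data.Unit using (⊤; tt)
open import Data.Vec using (lookup; tabulate)
open import Data.Vec.Membership.Propositional using (_∈_)
open import Data.Vec.Membership.Propositional.Properties using (∈-lookup; ∈-tabulate⁺)
open import Data.Vec.Properties using (lookup∘tabulate; tabulate-cong)
open import Data.Vec.Relation.Unary.Any using (index)
open import Data.Vec.Relation.Unary.Any.Properties using (lookup-index)
open import Data.Vec.Relation.Unary.Unique.Propositional.Properties
  using (lookup-injective; tabulate⁺)
open import Function using (mk⇔; Equivalence; _∘_)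
open import Relation.Binary.Definitions using (tri<; tri≈; tri>)
open import Relation.Binary.PropositionalEquality
open import Relation.Nullary using (¬_; Dec; yes; no; contradiction; map′)
open import Relation.Nullary.Decidable
  using (_×-dec_; ¬?; ⌊_⌋; toWitness; fromWitness; from-yes)

-- Balance is the useful intermediate property because its failure shows in a finite word: the bound
-- 10 becomes a statement about finitely many words, which a count of the factors of an infinite
-- word does not give directly. The search grows words to the left since the right end of the window
-- is fixed by the claim, while the left context needed differs from branch to branch. Factors are
-- handled as positions that agree on `n` letters, so every use of the complexity is a pigeonhole
-- argument on positions. The slope √2 - 1 keeps the example within the natural numbers: comparing m
-- with n√2 means comparing `m * m` with `2 * (n * n)`, and Pell's equations supply the
-- approximations.

-- Factors compared through their positions

record Agree (x : InfiniteWord) (n i j : ℕ) : Set where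
  constructor agree
  field at : ∀ k → k < n → x (i + k) ≡ x (j + k)

open Agree

agree? : ∀ x n i j → Dec (Agree x n i j)
agree? x n i j =
  map′ (λ h → agree λ k → h {k}) (λ e {k} → at e k) (allUpTo? (λ k → x (i + k) ≟ x (j + k)) n)

module _ {x : InfiniteWord} where

  agree-refl : ∀ {n i} → Agree x n i i
  agree-refl = agree λ k k<n → refl

  agree-sym : ∀ {n i j} → Agree x n i j → Agree x n j i
  agree-sym e = agree λ k k<n → sym (at e k k<n)

  agree-trans : ∀ {n i j l} → Agree x n i j → Agree x n j l → Agree x n i l
  agree-trans e f = agree λ k k<n → trans (at e k k<n) (at f k k<n)

  agree-head : ∀ {n i j} → Agree x (suc n) i j → x i ≡ x j
  agree-head {i = i} {j} e =
    subst₂ (λ a b → x a ≡ x b) (+-identityʳ i) (+-identityʳ j) (at e 0 z<s)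

  agree-tail : ∀ {n i j} → Agree x (suc n) i j → Agree x n (suc i) (suc j)
  agree-tail {i = i} {j} e = agree λ k k<n →
    subst₂ (λ a b → x a ≡ x b) (+-suc i k) (+-suc j k) (at e (suc k) (s<s k<n))

  agree-cons : ∀ {n i j} → x i ≡ x j → Agree x n (suc i) (suc j) → Agree x (suc n) i j
  agree-cons {i = i} {j} h e = agree λ where
    zero _ → subst₂ (λ a b → x a ≡ x b) (sym (+-identityʳ i)) (sym (+-identityʳ j)) h
    (suc k) k<n → subst₂ (λ a b → x a ≡ x b) (sym (+-suc i k)) (sym (+-suc j k)) (at e k (s<s⁻¹ k<n))

  agree-init : ∀ {n i j} → Agree x (suc n) i j → Agree x n i j
  agree-init e = agree λ k k<n → at e k (m<n⇒m<1+n k<n)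

  agree-last : ∀ {n i j} → Agree x (suc n) i j → x (i + n) ≡ x (j + n)
  agree-last {n} e = at e n ≤-refl

  agree-snoc : ∀ {n i j} → Agree x n i j → x (i + n) ≡ x (j + n) → Agree x (suc n) i j
  agree-snoc {n} {i} {j} e h = agree go
    where
    go : ∀ k → k < suc n → x (i + k) ≡ x (j + k)
    go k k<1+n with m≤n⇒m<n∨m≡n (s≤s⁻¹ k<1+n)
    ... | inj₁ k<n = at e k k<n
    ... | inj₂ refl = h

  agree⇒block≡ : ∀ {n i j} → Agree x n i j → block x i n ≡ block x j n
  agree⇒block≡ e = tabulate-cong λ k → at e (toℕ k) (toℕ<n k)

  lookup-block : ∀ i {n k} (k<n : k < n) → lookup (block x i n) (fromℕ< k<n) ≡ x (i + k)
  lookup-block i k<n =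
    trans (lookup∘tabulate _ (fromℕ< k<n)) (cong (λ l → x (i + l)) (toℕ-fromℕ< k<n))

  block≡⇒agree : ∀ {n i j} → block x i n ≡ block x j n → Agree x n i j
  block≡⇒agree {i = i} {j} eq = agree λ k k<n →
    trans (sym (lookup-block i k<n)) (trans (cong (λ w → lookup w (fromℕ< k<n)) eq) (lookup-block j k<n))

-- Complexity n + 1 as a system of n + 1 representative positions

Representatives : InfiniteWord → ℕ → Set
Representatives x n =
  Σ[ r ∈ (Fin (suc n) → ℕ) ] (∀ s t → Agree x n (r s) (r t) → s ≡ t)
                           × (∀ i → ∃[ t ] Agree x n i (r t))

sturmian⇒representatives : ∀ {x} → Sturmian x → ∀ n → Representatives x n
sturmian⇒representatives {x} st n = r , distinct , cover
  where
  as = proj₁ (st n)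
  unique = proj₁ (proj₂ (st n))
  complete = proj₂ (proj₂ (st n))
  occurrence : ∀ t → IsFactor x (lookup as t)
  occurrence t = Equivalence.to (complete (lookup as t)) (∈-lookup t as)
  r : Fin (suc n) → ℕ
  r t = proj₁ (occurrence t)
  distinct : ∀ s t → Agree x n (r s) (r t) → s ≡ t
  distinct s t e = lookup-injective unique s t
    (trans (sym (proj₂ (occurrence s))) (trans (agree⇒block≡ e) (proj₂ (occurrence t))))
  cover : ∀ i → ∃[ t ] Agree x n i (r t)
  cover i =
    let i∈as = Equivalence.from (complete (block x i n)) (i , refl)
        t = index i∈as
    in t , block≡⇒agree (trans (lookup-index i∈as) (sym (proj₂ (occurrence t))))

representatives⇒sturmian : ∀ {x} → (∀ n → Representatives x n) → Sturmian x
representatives⇒sturmian {x} reps n with reps n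
... | r , distinct , cover =
  tabulate w , tabulate⁺ (λ {s} {t} eq → distinct s t (block≡⇒agree eq)) ,
  λ a → mk⇔ (λ a∈ → let t = index a∈ in
                r t , sym (trans (lookup-index a∈) (lookup∘tabulate w t)))
             (λ { (i , refl) → subst (_∈ tabulate w) (sym (agree⇒block≡ (proj₂ (cover i))))
                                 (∈-tabulate⁺ w (proj₁ (cover i))) })
  where
  w : Fin (suc n) → Word n
  w t = block x (r t) n

-- Aperiodicity and right special factors

binary : ∀ {a b c : Fin 2} → a ≢ b → c ≢ b → a ≡ c
binary {zero} {_} {zero} _ _ = refl
binary {suc zero} {_} {suc zero} _ _ = refl
binary {zero} {zero} {suc zero} p _ = contradiction refl p
binary {zero} {suc zero} {suc zero} _ q = contradiction refl q
binary {suc zero} {zero} {zero} _ q = contradiction refl q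
binary {suc zero} {suc zero} {zero} p _ = contradiction refl p

-- Periodicity moves every position below `p + d` without changing what is read from it, so at most
-- `p + d` words of each length exist; at length `p + d` there should be one more.
eventually-periodic⇒⊥ : ∀ {x} → (∀ n → Representatives x n) →
  ∀ p d → 1 ≤ d → (∀ k → p ≤ k → x k ≡ x (k + d)) → ⊥
eventually-periodic⇒⊥ {x} reps p d 1≤d per with reps (p + d)
... | r , distinct , _ =
  let s , t , s<t , eq = pigeonhole (n<1+n (p + d)) (λ t → fromℕ< (proj₁ (proj₂ (reduce (r t)))))
      s' , s'< , es = reduce (r s)
      t' , t'< , et = reduce (r t)
      eq' : s' ≡ t'
      eq' = fromℕ<-injective s' t' s'< t'< eq
  in <⇒≢ s<t (cong toℕ (distinct s t
       (agree-trans (es (p + d)) (subst (λ u → Agree x (p + d) u (r t)) (sym eq') (agree-sym (et (p + d)))))))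
  where
  reduce : ∀ s → ∃[ s' ] s' < p + d × (∀ n → Agree x n s s')
  reduce = <-rec _ λ s rec → step s rec
    where
    step : ∀ s → (∀ {u} → u < s → ∃[ s' ] s' < p + d × (∀ n → Agree x n u s')) →
           ∃[ s' ] s' < p + d × (∀ n → Agree x n s s')
    step s rec with s <? p + d
    ... | yes s< = s , s< , λ n → agree-refl
    ... | no s≮ =
      let p+d≤s = ≮⇒≥ s≮
          d≤s = ≤-trans (m≤n+m d p) p+d≤s
          u = s ∸ d
          p≤u : p ≤ u
          p≤u = subst (_≤ u) (m+n∸n≡m p d) (∸-monoˡ-≤ d p+d≤s)
          u<s : u < s
          u<s = ∸-monoʳ-< {s} 1≤d d≤s
          s' , s'< , e = rec u<s
          shift : ∀ k → x (s + k) ≡ x (u + k)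
          shift k = trans
            (cong x (trans (cong (_+ k) (sym (m∸n+n≡m d≤s)))
                     (trans (+-assoc u d k) (trans (cong (u +_) (+-comm d k)) (sym (+-assoc u k d))))))
            (sym (per (u + k) (≤-trans p≤u (m≤m+n u k))))
      in s' , s'< , λ n → agree λ k k<n → trans (shift k) (at (e n) k k<n)

module _ {x : InfiniteWord} (reps : ∀ n → Representatives x n) where

  two-of-too-many-agree : ∀ n (f : Fin (2 + n) → ℕ) →
    ∃[ s ] ∃[ t ] toℕ s < toℕ t × Agree x n (f s) (f t)
  two-of-too-many-agree n f with reps n
  ... | r , _ , cover =
    let s , t , s<t , eq = pigeonhole (n<1+n (suc n)) (λ t → proj₁ (cover (f t)))
    in s , t , s<t ,
       agree-trans (proj₂ (cover (f s)))
         (subst (λ u → Agree x n (r u) (f t)) (sym eq) (agree-sym (proj₂ (cover (f t)))))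

  -- The representatives for length m already show m + 1 words of length m + 1. Each right special
  -- word adds one that no representative shows (`other`), so two different ones would make m + 3.
  right-special-unique : ∀ {m i i' j j'} →
    Agree x m i i' → x (i + m) ≢ x (i' + m) →
    Agree x m j j' → x (j + m) ≢ x (j' + m) → Agree x m i j
  right-special-unique {m} {i} {i'} {j} {j'} ei ni ej nj with agree? x m i j
  ... | yes e = e
  ... | no ¬e with reps m
  ... | r , distinct , cover = ⊥-elim (absurd (two-of-too-many-agree (suc m) f))
    where
    other : ∀ {i i'} → Agree x m i i' → x (i + m) ≢ x (i' + m) →
            ∃[ e ] Agree x m e i × (∀ t → ¬ Agree x (suc m) e (r t))
    other {i} {i'} ei ni with cover i
    ... | t , et with x (i + m) ≟ x (r t + m)
    ... | yes eq = i' , agree-sym ei , λ u eu →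
      contradiction
        (trans eq (trans (cong (λ v → x (r v + m))
          (distinct t u (agree-trans (agree-sym et) (agree-trans ei (agree-init eu))))) (sym (agree-last eu))))
        ni
    ... | no ne = i , agree-refl , λ u eu →
      contradiction
        (trans (agree-last eu) (cong (λ v → x (r v + m))
          (sym (distinct t u (agree-trans (agree-sym et) (agree-init eu))))))
        ne
    oi = other ei ni
    oj = other ej nj
    f : Fin (3 + m) → ℕ
    f zero = proj₁ oi
    f (suc zero) = proj₁ oj
    f (suc (suc t)) = r t
    absurd : ∃[ s ] ∃[ t ] toℕ s < toℕ t × Agree x (suc m) (f s) (f t) → ⊥
    absurd (zero , suc zero , _ , e) =
      ¬e (agree-trans (agree-sym (proj₁ (proj₂ oi))) (agree-trans (agree-init e) (proj₁ (proj₂ oj))))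
    absurd (zero , suc (suc t) , _ , e) = proj₂ (proj₂ oi) t e
    absurd (suc zero , suc (suc t) , _ , e) = proj₂ (proj₂ oj) t e
    absurd (suc (suc s) , suc (suc t) , s<t , e) =
      <⇒≢ s<t (cong (λ u → 2 + toℕ u) (distinct s t (agree-init e)))
    absurd (suc zero , suc zero , s<s () , _)
    absurd (suc (suc _) , suc zero , s<s () , _)

  -- The word of length m at i is not right special.
  RightDetermined : ℕ → ℕ → Set
  RightDetermined m i = ∀ s → Agree x m i s → x (i + m) ≡ x (s + m)

  -- A determined next letter carries the agreement one position further. The window of d determined
  -- positions slides along: the position that enters it bears the same word as the one that leaves.
  -- Hence x has period d from p on.
  determined-recurrence⇒⊥ : ∀ m p d → 1 ≤ d → Agree x (suc m) p (p + d) →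
    (∀ t → t < d → RightDetermined (suc m) (p + t)) → ⊥
  determined-recurrence⇒⊥ m p d 1≤d e₀ ns₀ =
    eventually-periodic⇒⊥ reps p d 1≤d λ k p≤k →
      subst (λ l → x l ≡ x (l + d)) (m∸n+n≡m p≤k) (agree-head (proj₁ (claim (k ∸ p))))
    where
    claim : ∀ k → Agree x (suc m) (k + p) (k + p + d)
                × (∀ t → t < d → RightDetermined (suc m) (k + p + t))
    claim zero = e₀ , ns₀
    claim (suc k) with claim k
    ... | e , ns = agree-tail (agree-snoc e (first _ e)) , next
      where
      first : RightDetermined (suc m) (k + p)
      first = subst (RightDetermined (suc m)) (+-identityʳ (k + p)) (ns 0 1≤d)
      next : ∀ t → t < d → RightDetermined (suc m) (suc (k + p) + t)
      next t t<d with m≤n⇒m<n∨m≡n t<d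
      ... | inj₁ 1+t<d = subst (RightDetermined (suc m)) (+-suc (k + p) t) (ns (suc t) 1+t<d)
      ... | inj₂ refl = subst (RightDetermined (suc m)) (+-suc (k + p) t)
            λ s es → trans (sym (first _ e)) (first s (agree-trans e es))

  -- Here a w a occurs at i and b w b at j, with a ≠ b, w a palindrome of length N, and
  -- a w always followed by a.  An occurrence of b w at i + k would contradict the
  -- palindrome; so a w and b w being the only candidates for a right special word,
  -- nothing in the N + 2 positions from i on is right special, and the words of length
  -- N + 1 there, which omit b w, repeat: x would be eventually periodic.
  nonspecial⇒⊥ : ∀ N i j → x i ≢ x j → x j ≡ x (j + suc N) →
    Agree x N (suc i) (suc j) →
    (∀ k → k ≤ suc N → x (i + k) ≡ x (i + (suc N ∸ k))) →
    (∀ s → Agree x (suc N) i s → x (s + suc N) ≡ x i) → ⊥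
  nonspecial⇒⊥ N i j xi≢xj xj inner pal followed = collide (two-of-too-many-agree (suc N) f)
    where
    xi : x i ≡ x (i + suc N)
    xi = subst (λ l → x l ≡ x (i + suc N)) (+-identityʳ i) (pal 0 z≤n)

    inner-at : ∀ k → 0 < k → k < suc N → x (i + k) ≡ x (j + k)
    inner-at (suc k) _ k<N =
      subst₂ (λ a b → x a ≡ x b) (sym (+-suc i k)) (sym (+-suc j k)) (at inner k (s<s⁻¹ k<N))

    avoids : ∀ k → k ≤ suc N → ¬ Agree x (suc N) (i + k) j
    avoids zero _ e = xi≢xj (subst (λ l → x l ≡ x j) (+-identityʳ i) (agree-head e))
    avoids k@(suc k') k≤ e with m≤n⇒m<n∨m≡n k≤
    ... | inj₂ refl = xi≢xj (trans xi (agree-head e))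
    -- The letter at `i + suc N` is a. Read inside the supposed occurrence of b w at `i + k`, it is
    -- also the letter of a w a at offset `suc N ∸ k`, whose mirror image at offset k is the initial
    -- b.
    ... | inj₁ k< = xi≢xj (begin
      x i                      ≡⟨ xi ⟩
      x (i + suc N)            ≡⟨ cong (λ l → x (i + l)) (sym (m+[n∸m]≡n k≤)) ⟩
      x (i + (k + (suc N ∸ k))) ≡⟨ cong x (sym (+-assoc i k _)) ⟩
      x (i + k + (suc N ∸ k))  ≡⟨ at e (suc N ∸ k) (s≤s (m∸n≤m N k')) ⟩
      x (j + (suc N ∸ k))      ≡⟨ sym (inner-at (suc N ∸ k) (m<n⇒0<n∸m k<) (s≤s (m∸n≤m N k'))) ⟩
      x (i + (suc N ∸ k))      ≡⟨ sym (pal k k≤) ⟩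
      x (i + k)                ≡⟨ agree-head e ⟩
      x j                      ∎)
      where open ≡-Reasoning

    suc-offset : ∀ {l l'} → x (l + suc N) ≢ x (l' + suc N) → x (suc l + N) ≢ x (suc l' + N)
    suc-offset {l} {l'} = subst₂ (λ a b → x a ≢ x b) (+-suc l N) (+-suc l' N)

    -- Since w itself is right special, a word with two continuations ends in w, by uniqueness. It
    -- is a w, excluded by `followed`, or b w, excluded by `avoids`.
    determined : ∀ k → k ≤ suc N → RightDetermined (suc N) (i + k)
    determined k k≤ s e with x (i + k + suc N) ≟ x (s + suc N)
    ... | yes eq = eq
    ... | no ne with x (i + k) ≟ x i
                   | right-special-unique (agree-tail e) (suc-offset {i + k} {s} ne)
                       inner (suc-offset {i} {j} λ q → xi≢xj (trans xi (trans q (sym xj))))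
    ...   | yes h | a =
      let b = agree-cons h a
      in contradiction (trans (followed _ (agree-sym b)) (sym (followed s (agree-trans (agree-sym b) e)))) ne
    ...   | no h | a =
      contradiction (agree-cons (binary h (xi≢xj ∘ sym)) (agree-trans a inner)) (avoids k k≤)

    f : Fin (3 + N) → ℕ
    f zero = j
    f (suc t) = i + toℕ t
    collide : ∃[ s ] ∃[ t ] toℕ s < toℕ t × Agree x (suc N) (f s) (f t) → ⊥
    collide (zero , suc t , _ , e) = avoids (toℕ t) (s≤s⁻¹ (toℕ<n t)) (agree-sym e)
    collide (suc s , suc t , s<t , e) =
      determined-recurrence⇒⊥ N (i + a) (b ∸ a) (m<n⇒0<n∸m a<b)
        (subst (Agree x (suc N) (i + a)) (trans (cong (i +_) (sym (m+[n∸m]≡n (<⇒≤ a<b)))) (sym (+-assoc i a (b ∸ a)))) e)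
        λ u u< → subst (RightDetermined (suc N)) (sym (+-assoc i a u))
          (determined (a + u) (≤-trans (<⇒≤ (subst (a + u <_) (m+[n∸m]≡n (<⇒≤ a<b)) (+-monoʳ-< a u<))) (s≤s⁻¹ (toℕ<n t))))
      where
      a = toℕ s
      b = toℕ t
      a<b : a < b
      a<b = s<s⁻¹ s<t

-- Balance of Sturmian words

count : InfiniteWord → ℕ → ℕ → ℕ
count x i zero = 0
count x i (suc n) = toℕ (x i) + count x (suc i) n

count-+ : ∀ x i m n → count x i (m + n) ≡ count x i m + count x (i + m) n
count-+ x i zero n = cong (λ l → count x l n) (sym (+-identityʳ i))
count-+ x i (suc m) n = begin
  toℕ (x i) + count x (suc i) (m + n)
    ≡⟨ cong (toℕ (x i) +_) (count-+ x (suc i) m n) ⟩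
  toℕ (x i) + (count x (suc i) m + count x (suc i + m) n)
    ≡⟨ sym (+-assoc (toℕ (x i)) _ _) ⟩
  toℕ (x i) + count x (suc i) m + count x (suc i + m) n
    ≡⟨ cong (λ l → toℕ (x i) + count x (suc i) m + count x l n) (sym (+-suc i m)) ⟩
  toℕ (x i) + count x (suc i) m + count x (i + suc m) n ∎
  where open ≡-Reasoning

count-suc : ∀ x i n → count x i (suc n) ≡ count x i n + toℕ (x (i + n))
count-suc x i n = begin
  count x i (suc n)                      ≡⟨ cong (count x i) (+-comm 1 n) ⟩
  count x i (n + 1)                      ≡⟨ count-+ x i n 1 ⟩
  count x i n + (toℕ (x (i + n)) + 0)    ≡⟨ cong (count x i n +_) (+-identityʳ _) ⟩
  count x i n + toℕ (x (i + n))          ∎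
  where open ≡-Reasoning

BalancedAt : InfiniteWord → ℕ → Set
BalancedAt x n = ∀ i j → count x i n ≤ suc (count x j n)

Balanced : InfiniteWord → Set
Balanced x = ∀ n → BalancedAt x n

toℕ≤1 : ∀ (a : Fin 2) → toℕ a ≤ 1
toℕ≤1 a = s≤s⁻¹ (toℕ<n a)

split-excess : ∀ {a b c d} → a ≤ suc c → b ≤ suc d → 2 + (c + d) ≤ a + b →
  a ≡ suc c × b ≡ suc d
split-excess {a} {b} {c} {d} a≤ b≤ h =
  ≤-antisym a≤ (+-cancelʳ-≤ (suc d) (suc c) a
    (≤-trans (≤-reflexive (cong suc (+-suc c d))) (≤-trans h (+-monoʳ-≤ a b≤)))) ,
  ≤-antisym b≤ (+-cancelˡ-≤ (suc c) (suc d) b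
    (≤-trans (≤-reflexive (cong suc (+-suc c d))) (≤-trans h (+-monoˡ-≤ b a≤))))

-- In a shortest unbalanced pair of factors, at i and j, every proper prefix and
-- suffix has excess exactly one; hence they are 1w1 and 0w0, and w is a palindrome.
module MinimalUnbalanced {x : InfiniteWord} (N i j : ℕ)
  (shorter : ∀ {k} → k < 2 + N → BalancedAt x k)
  (excess : 2 + count x j (2 + N) ≤ count x i (2 + N)) where

  n = 2 + N
  m = 1 + N

  halves : ∀ k → 0 < k → k < n →
    count x i k ≡ suc (count x j k) × count x (i + k) (n ∸ k) ≡ suc (count x (j + k) (n ∸ k))
  halves k 0<k k<n = split-excess (shorter k<n i j) (shorter (∸-monoʳ-< 0<k (<⇒≤ k<n)) _ _)
    (subst₂ (λ a b → 2 + a ≤ b) (whole j) (whole i) excess)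
    where
    whole : ∀ l → count x l n ≡ count x l k + count x (l + k) (n ∸ k)
    whole l = trans (cong (count x l) (sym (m+[n∸m]≡n (<⇒≤ k<n)))) (count-+ x l k (n ∸ k))

  heads : toℕ (x i) ≡ suc (toℕ (x j))
  heads = subst₂ (λ a b → a ≡ suc b) (+-identityʳ _) (+-identityʳ _) (proj₁ (halves 1 z<s (s<s z<s)))

  head≢ : x i ≢ x j
  head≢ eq = m≢1+m+n _ (trans (cong toℕ (sym eq)) (trans heads (cong suc (sym (+-identityʳ _)))))

  last≢ : x (i + m) ≢ x (j + m)
  last≢ eq = <⇒≱ excess (begin
    count x i n                          ≡⟨ count-suc x i m ⟩
    count x i m + toℕ (x (i + m))        ≡⟨ cong₂ _+_ (proj₁ (halves m z<s ≤-refl)) (cong toℕ eq) ⟩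
    suc (count x j m) + toℕ (x (j + m))  ≡⟨ cong suc (sym (count-suc x j m)) ⟩
    suc (count x j n)                    ∎)
    where open ≤-Reasoning

  -- Prefixes of consecutive lengths have the same excess, so the letters by which they grow are
  -- equal.
  inner : Agree x N (suc i) (suc j)
  inner = agree λ k k<N → subst₂ (λ a b → x a ≡ x b) (+-suc i k) (+-suc j k)
    (toℕ-injective (+-cancelˡ-≡ (suc (count x j (suc k))) _ _ (begin
      suc (count x j (suc k)) + toℕ (x (i + suc k))
        ≡⟨ cong (_+ toℕ (x (i + suc k))) (sym (proj₁ (halves (suc k) z<s (s<s (m<n⇒m<1+n k<N))))) ⟩
      count x i (suc k) + toℕ (x (i + suc k))
        ≡⟨ sym (count-suc x i (suc k)) ⟩
      count x i (2 + k)
        ≡⟨ proj₁ (halves (2 + k) z<s (s<s (s<s k<N))) ⟩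
      suc (count x j (2 + k))
        ≡⟨ cong suc (count-suc x j (suc k)) ⟩
      suc (count x j (suc k)) + toℕ (x (j + suc k)) ∎)))
    where open ≡-Reasoning

  -- Prefix and suffix at i each exceed their counterpart at j by one. Balance applied crosswise
  -- bounds the prefix at i by one more than the suffix at j, which is the suffix at i; the converse
  -- bound is symmetric.
  prefix≡suffix : ∀ k → k ≤ n → count x i k ≡ count x (i + (n ∸ k)) k
  prefix≡suffix zero _ = refl
  prefix≡suffix (suc k) k≤n with m≤n⇒m<n∨m≡n k≤n
  ... | inj₂ refl = cong (λ l → count x l n) (sym (trans (cong (i +_) (n∸n≡0 n)) (+-identityʳ i)))
  ... | inj₁ k<n = ≤-antisym
    (≤-trans (shorter k<n i (j + k′)) (≤-reflexive (sym suffix)))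
    (≤-trans (shorter k<n (i + k′) j) (≤-reflexive (sym (proj₁ (halves (suc k) z<s k<n)))))
    where
    k′ = n ∸ suc k
    suffix : count x (i + k′) (suc k) ≡ suc (count x (j + k′) (suc k))
    suffix = subst (λ l → count x (i + k′) l ≡ suc (count x (j + k′) l)) (m∸[m∸n]≡n (<⇒≤ k<n))
      (proj₂ (halves k′ (m<n⇒0<n∸m k<n) (∸-monoʳ-< {n} z<s (<⇒≤ k<n))))

  -- The letters are the differences of consecutive prefix counts and of consecutive suffix counts.
  palindromeᵢ : ∀ k → k ≤ m → x (i + k) ≡ x (i + (m ∸ k))
  palindromeᵢ k k≤m = toℕ-injective (+-cancelˡ-≡ (count x i k) _ _ (begin
    count x i k + toℕ (x (i + k))
      ≡⟨ sym (count-suc x i k) ⟩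
    count x i (suc k)
      ≡⟨ prefix≡suffix (suc k) (s≤s k≤m) ⟩
    toℕ (x (i + (m ∸ k))) + count x (suc (i + (m ∸ k))) k
      ≡⟨ +-comm (toℕ (x (i + (m ∸ k)))) _ ⟩
    count x (suc (i + (m ∸ k))) k + toℕ (x (i + (m ∸ k)))
      ≡⟨ cong (λ l → count x l k + toℕ (x (i + (m ∸ k))))
           (trans (sym (+-suc i (m ∸ k))) (cong (i +_) (sym (+-∸-assoc 1 k≤m)))) ⟩
    count x (i + (n ∸ k)) k + toℕ (x (i + (m ∸ k)))
      ≡⟨ cong (_+ toℕ (x (i + (m ∸ k)))) (sym (prefix≡suffix k (m≤n⇒m≤1+n k≤m))) ⟩
    count x i k + toℕ (x (i + (m ∸ k))) ∎))
    where open ≡-Reasoning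

  ends≡ᵢ : x i ≡ x (i + m)
  ends≡ᵢ = subst (λ l → x l ≡ x (i + m)) (+-identityʳ i) (palindromeᵢ 0 z≤n)

  ends≡ⱼ : x j ≡ x (j + m)
  ends≡ⱼ = binary (head≢ ∘ sym) (λ q → last≢ (trans (sym ends≡ᵢ) (sym q)))

  inner-at : ∀ k → 0 < k → k < m → x (i + k) ≡ x (j + k)
  inner-at (suc k) _ k<m =
    subst₂ (λ a b → x a ≡ x b) (sym (+-suc i k)) (sym (+-suc j k)) (at inner k (s<s⁻¹ k<m))

  palindromeⱼ : ∀ k → k ≤ m → x (j + k) ≡ x (j + (m ∸ k))
  palindromeⱼ zero _ = trans (cong x (+-identityʳ j)) ends≡ⱼ
  palindromeⱼ k@(suc k₀) k≤m with m≤n⇒m<n∨m≡n k≤m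
  ... | inj₂ refl = trans (sym ends≡ⱼ) (cong x (sym (trans (cong (j +_) (n∸n≡0 m)) (+-identityʳ j))))
  ... | inj₁ k<m = begin
    x (j + k)        ≡⟨ sym (inner-at k z<s k<m) ⟩
    x (i + k)        ≡⟨ palindromeᵢ k k≤m ⟩
    x (i + (m ∸ k))  ≡⟨ inner-at (m ∸ k) (m<n⇒0<n∸m k<m) (s≤s (m∸n≤m N k₀)) ⟩
    x (j + (m ∸ k))  ∎
    where open ≡-Reasoning

  module _ (reps : ∀ n → Representatives x n) where

    -- The word of length m at l is right special.
    FollowedByOther : ℕ → Set
    FollowedByOther l = ∃[ s ] Agree x m l s × x (l + m) ≢ x (s + m)

    -- Representatives for length m + 1 show every continuation, so finitely many positions decide.
    followedByOther? : ∀ l → Dec (FollowedByOther l)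
    followedByOther? l with reps (suc m)
    ... | r , _ , cover with any? (λ t → agree? x m l (r t) ×-dec ¬? (x (l + m) ≟ x (r t + m)))
    ... | yes (t , e , ne) = yes (r t , e , ne)
    ... | no ¬special = no λ { (s , e , ne) → let t , et = cover s in
          ¬special (t , agree-trans e (agree-init et) , λ q → ne (trans q (sym (agree-last et)))) }

    nonspecial : ∀ l → x l ≡ x (l + m) → ¬ FollowedByOther l →
      ∀ s → Agree x m l s → x (s + m) ≡ x l
    nonspecial l ends ¬special s e with x (s + m) ≟ x l
    ... | yes q = q
    ... | no ne = ⊥-elim (¬special (s , e , λ q → ne (trans (sym q) (sym ends))))

    impossible : ⊥
    impossible with followedByOther? i | followedByOther? j
    ... | yes (s , es , ns) | yes (t , et , nt) =
      head≢ (agree-head (right-special-unique reps es ns et nt))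
    ... | no ¬special | _ =
      nonspecial⇒⊥ reps N i j head≢ ends≡ⱼ inner palindromeᵢ (nonspecial i ends≡ᵢ ¬special)
    ... | yes _ | no ¬special =
      nonspecial⇒⊥ reps N j i (head≢ ∘ sym) ends≡ᵢ (agree-sym inner) palindromeⱼ
        (nonspecial j ends≡ⱼ ¬special)

sturmian⇒balanced : ∀ {x} → Sturmian x → Balanced x
sturmian⇒balanced {x} st = <-rec _ step
  where
  step : ∀ n → (∀ {k} → k < n → BalancedAt x k) → BalancedAt x n
  step zero _ i j = z≤n
  step (suc zero) _ i j =
    ≤-trans (subst (_≤ 1) (sym (+-identityʳ (toℕ (x i)))) (toℕ≤1 (x i))) (s≤s z≤n)
  step (suc (suc N)) shorter i j = ≮⇒≥ λ excess →
    MinimalUnbalanced.impossible N i j shorter excess (sturmian⇒representatives st)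

-- Cubes without the minimality of the period

-- Here p may be any period, which leaves a plain comparison of letters; `cubeOfPeriod⇒cubeEndsAt`
-- restores the least period.
CubeOfPeriod : InfiniteWord → ℕ → ℕ → Set
CubeOfPeriod x n p = 1 ≤ p × 3 * p ≤ n × Agree x (2 * p) (n ∸ 3 * p) (n ∸ 3 * p + p)

cubeOfPeriod? : ∀ x n p → Dec (CubeOfPeriod x n p)
cubeOfPeriod? x n p = 1 ≤? p ×-dec 3 * p ≤? n ×-dec agree? x (2 * p) (n ∸ 3 * p) (n ∸ 3 * p + p)

3*p≡2*p+p : ∀ p → 3 * p ≡ 2 * p + p
3*p≡2*p+p p = +-comm p (2 * p)

p≤3*p : ∀ p → p ≤ 3 * p
p≤3*p p = m≤m+n p (2 * p)

agree⇒isPeriod : ∀ {x a p} → 1 ≤ p → Agree x (2 * p) a (a + p) → IsPeriod (block x a (3 * p)) p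
agree⇒isPeriod {x} {a} {p} 1≤p e = 1≤p , p≤3*p p , λ i j j≡i+p → begin
  lookup (block x a (3 * p)) i  ≡⟨ lookup∘tabulate _ i ⟩
  x (a + toℕ i)                 ≡⟨ at e (toℕ i) (+-cancelʳ-< p _ _
                                     (subst₂ _<_ j≡i+p (3*p≡2*p+p p) (toℕ<n j))) ⟩
  x (a + p + toℕ i)             ≡⟨ cong x (trans (+-assoc a p _) (cong (a +_) (trans (+-comm p _) (sym j≡i+p)))) ⟩
  x (a + toℕ j)                 ≡⟨ sym (lookup∘tabulate _ j) ⟩
  lookup (block x a (3 * p)) j  ∎
  where open ≡-Reasoning

isPeriod⇒agree : ∀ {x a n p q} → IsPeriod (block x a n) q → p + q ≤ n → Agree x p a (a + q)
isPeriod⇒agree {x} {a} {n} {p} {q} (_ , _ , period) p+q≤n = agree λ k k<p →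
  let q+k<n = <-≤-trans (subst (_< p + q) (+-comm k q) (+-monoˡ-< q k<p)) p+q≤n
      k<n = ≤-<-trans (m≤n+m k q) q+k<n
  in begin
  x (a + k)                              ≡⟨ sym (lookup-block {x} a k<n) ⟩
  lookup (block x a n) (fromℕ< k<n)      ≡⟨ period _ _ (trans (toℕ-fromℕ< q+k<n)
                                              (trans (+-comm q k) (cong (_+ q) (sym (toℕ-fromℕ< k<n))))) ⟩
  lookup (block x a n) (fromℕ< q+k<n)    ≡⟨ lookup-block {x} a q+k<n ⟩
  x (a + (q + k))                        ≡⟨ cong x (sym (+-assoc a q k)) ⟩
  x (a + q + k)                          ∎
  where open ≡-Reasoning

cubeEndsAt⇒cubeOfPeriod : ∀ {x n} → CubeEndsAt x n → ∃[ p ] CubeOfPeriod x n p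
cubeEndsAt⇒cubeOfPeriod (_ , _ , m≤n , p , (period , _) , refl) =
  p , proj₁ period , m≤n , isPeriod⇒agree period (≤-reflexive (sym (3*p≡2*p+p p)))

-- A period q of the cube makes its suffix of length 3q a cube as well, so the
-- least p for which a cube of period p ends at n is the least period of that cube.
cubeOfPeriod⇒cubeEndsAt : ∀ {x n} p → CubeOfPeriod x n p → CubeEndsAt x n
cubeOfPeriod⇒cubeEndsAt {x} {n} = <-rec _ step
  where
  step : ∀ p → (∀ {q} → q < p → CubeOfPeriod x n q → CubeEndsAt x n) →
         CubeOfPeriod x n p → CubeEndsAt x n
  step p smaller (1≤p , 3p≤n , e) with anyUpTo? (cubeOfPeriod? x n) p
  ... | yes (q , q<p , c) = smaller q<p c
  ... | no none = 3 * p , ≤-trans 1≤p (p≤3*p p) , 3p≤n , p ,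
                  (agree⇒isPeriod 1≤p e , λ q per → ≮⇒≥ λ q<p → none (q , q<p , suffix q<p per)) , refl
    where
    suffix : ∀ {q} → q < p → IsPeriod (block x (n ∸ 3 * p) (3 * p)) q → CubeOfPeriod x n q
    suffix {q} q<p per = proj₁ per , 3q≤n , agree shifted
      where
      3q≤3p = *-monoʳ-≤ 3 (<⇒≤ q<p)
      3q≤n = ≤-trans 3q≤3p 3p≤n
      d = 3 * p ∸ 3 * q
      start : n ∸ 3 * q ≡ n ∸ 3 * p + d
      start = begin
        n ∸ 3 * q                    ≡⟨ cong (_∸ 3 * q) (sym (m∸n+n≡m 3p≤n)) ⟩
        n ∸ 3 * p + 3 * p ∸ 3 * q    ≡⟨ +-∸-assoc (n ∸ 3 * p) 3q≤3p ⟩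
        n ∸ 3 * p + d                ∎
        where open ≡-Reasoning
      e′ : Agree x (d + 2 * q) (n ∸ 3 * p) (n ∸ 3 * p + q)
      e′ = isPeriod⇒agree per (≤-reflexive (begin
        d + 2 * q + q    ≡⟨ +-assoc d (2 * q) q ⟩
        d + (2 * q + q)  ≡⟨ cong (d +_) (sym (3*p≡2*p+p q)) ⟩
        d + 3 * q        ≡⟨ m∸n+n≡m 3q≤3p ⟩
        3 * p            ∎))
        where open ≡-Reasoning
      shifted : ∀ k → k < 2 * q → x (n ∸ 3 * q + k) ≡ x (n ∸ 3 * q + q + k)
      shifted k k< = begin
        x (n ∸ 3 * q + k)            ≡⟨ cong (λ l → x (l + k)) start ⟩
        x (n ∸ 3 * p + d + k)        ≡⟨ cong x (+-assoc (n ∸ 3 * p) d k) ⟩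
        x (n ∸ 3 * p + (d + k))      ≡⟨ at e′ (d + k) (+-monoʳ-< d k<) ⟩
        x (n ∸ 3 * p + q + (d + k))  ≡⟨ cong x (sym (+-assoc (n ∸ 3 * p + q) d k)) ⟩
        x (n ∸ 3 * p + q + d + k)    ≡⟨ cong (λ l → x (l + k)) (trans (+-assoc (n ∸ 3 * p) q d)
                                          (trans (cong (n ∸ 3 * p +_) (+-comm q d)) (sym (+-assoc (n ∸ 3 * p) d q)))) ⟩
        x (n ∸ 3 * p + d + q + k)    ≡⟨ cong (λ l → x (l + q + k)) (sym start) ⟩
        x (n ∸ 3 * q + q + k)        ∎
        where open ≡-Reasoning

cubeEndsAt? : ∀ x n → Dec (CubeEndsAt x n)
cubeEndsAt? x n = map′
  (λ { (p , _ , c) → cubeOfPeriod⇒cubeEndsAt p c })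
  (λ c → let p , 1≤p , 3p≤n , e = cubeEndsAt⇒cubeOfPeriod c
         in p , s≤s (≤-trans (p≤3*p p) 3p≤n) , 1≤p , 3p≤n , e)
  (anyUpTo? (cubeOfPeriod? x n) (suc n))

-- Listing a decidable set with bounded gaps

module Enumeration {P : ℕ → Set} (P? : ∀ n → Dec (P n)) where

  least-from : ∀ a d → P (a + d) → ∃[ n ] a ≤ n × n ≤ a + d × P n × (∀ k → a ≤ k → k < n → ¬ P k)
  least-from a zero h = a + 0 , m≤m+n a 0 , ≤-refl , h ,
    λ k a≤k k<a → contradiction (subst (k <_) (+-identityʳ a) k<a) (≤⇒≯ a≤k)
  least-from a (suc d) h with P? a
  ... | yes Pa = a , ≤-refl , m≤m+n a (suc d) , Pa , λ k a≤k k<a → contradiction k<a (≤⇒≯ a≤k)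
  ... | no ¬Pa with least-from (suc a) d (subst P (+-suc a d) h)
  ... | n , a<n , n≤ , Pn , min = n , <⇒≤ a<n , ≤-trans n≤ (≤-reflexive (sym (+-suc a d))) , Pn , min′
    where
    min′ : ∀ k → a ≤ k → k < n → ¬ P k
    min′ k a≤k k<n with m≤n⇒m<n∨m≡n a≤k
    ... | inj₁ a<k = min k a<k k<n
    ... | inj₂ refl = ¬Pa

  module _ (G : ℕ) (start : ∃[ n ] P n)
           (next : ∀ n → P n → ∃[ m ] n < m × m ≤ n + G × P m) where

    Next : ℕ → Set
    Next n = ∃[ m ] n < m × m ≤ n + G × P m × (∀ k → n < k → k < m → ¬ P k)

    successor : ∀ n → P n → Next n
    successor n Pn =
      let m , n<m , m≤ , Pm = next n Pn
          l , n<l , l≤ , Pl , min = least-from (suc n) (m ∸ suc n) (subst P (sym (m+[n∸m]≡n n<m)) Pm)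
      in l , n<l , ≤-trans l≤ (≤-trans (≤-reflexive (m+[n∸m]≡n n<m)) m≤) , Pl , min

    first = least-from 0 (proj₁ start) (proj₂ start)

    element : ℕ → ∃[ n ] P n
    element zero = proj₁ first , proj₁ (proj₂ (proj₂ (proj₂ first)))
    element (suc i) =
      let n , Pn = element i
          m , _ , _ , Pm , _ = successor n Pn
      in m , Pm

    list : ℕ → ℕ
    list i = proj₁ (element i)

    next-element : ∀ i → Next (list i)
    next-element i = successor (list i) (proj₂ (element i))

    list-increasing : ∀ i → list i < list (suc i)
    list-increasing i = proj₁ (proj₂ (next-element i))

    i≤list : ∀ i → i ≤ list i
    i≤list zero = z≤n
    i≤list (suc i) = ≤-<-trans (i≤list i) (list-increasing i)

    -- Descends from an entry beyond `n`; by `i≤list` the entry with index `suc n` is one.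
    find : ∀ n → P n → ∀ i → n < list i → ∃[ j ] list j ≡ n
    find n Pn zero n<p = contradiction Pn (proj₂ (proj₂ (proj₂ (proj₂ first))) n z≤n n<p)
    find n Pn (suc i) n<p with <-cmp n (list i)
    ... | tri< n<pᵢ _ _ = find n Pn i n<pᵢ
    ... | tri≈ _ n≡pᵢ _ = i , sym n≡pᵢ
    ... | tri> _ _ n>pᵢ =
      contradiction Pn (proj₂ (proj₂ (proj₂ (proj₂ (next-element i)))) n n>pᵢ n<p)

    lists : Lists list P
    lists = list-increasing , λ n → mk⇔ (λ Pn → find n Pn (suc n) (i≤list (suc n)))
                                        (λ { (i , refl) → proj₂ (element i) })

    gap≤ : ∀ i → gap list i ≤ G
    gap≤ i = ≤-trans (∸-monoˡ-≤ (list i) (proj₁ (proj₂ (proj₂ (next-element i)))))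
                     (≤-reflexive (m+n∸m≡n (list i) G))

  gap-attained : ∀ {p G} → Lists p P → (∀ i → gap p i ≤ G) →
    ∀ n → P n → (∀ k → n < k → k < n + G → ¬ P k) → ∃[ i ] gap p i ≡ G
  gap-attained {p} {G} (inc , all) gap≤ n Pn none with Equivalence.to (all n) Pn
  ... | i , refl = i , ≤-antisym (gap≤ i) (subst (_≤ gap p i) (m+n∸m≡n (p i) G) (∸-monoˡ-≤ (p i)
          (≮⇒≥ λ lt → none (p (suc i)) (inc i) lt (Equivalence.from (all _) (suc i , refl)))))

-- Finite search over balanced words

Reads : InfiniteWord → ℕ → List (Fin 2) → Set
Reads x i [] = ⊤
Reads x i (a ∷ v) = x i ≡ a × Reads x (suc i) v

agreeᵇ : ℕ → List (Fin 2) → List (Fin 2) → Bool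
agreeᵇ (suc n) (a ∷ u) (b ∷ v) = ⌊ a ≟ b ⌋ ∧ agreeᵇ n u v
agreeᵇ zero _ _ = true
agreeᵇ _ _ _ = false

-- The accumulators `p` and `q` hold the ones already read in the two lists; a clash is a common
-- length at which the totals differ by two or more.
clash : ℕ → ℕ → List (Fin 2) → List (Fin 2) → Bool
clash p q (a ∷ u) (b ∷ v) =
  (suc (q + toℕ b) <ᵇ p + toℕ a) ∨ (suc (p + toℕ a) <ᵇ q + toℕ b)
  ∨ clash (p + toℕ a) (q + toℕ b) u v
clash _ _ _ _ = false

-- Comparing prefixes of `u` suffices: as words grow to the left, any two factors are compared when
-- the leftmost of them receives its first letter.
clashWithin : List (Fin 2) → List (Fin 2) → Bool
clashWithin u [] = false
clashWithin u (b ∷ v) = clash 0 0 u (b ∷ v) ∨ clashWithin u v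

-- Only cubes beginning at the left end of `v` are tested, those further right having been met
-- earlier. The second test puts the end among the last 10 positions.
recentCube : List (Fin 2) → ℕ → Bool
recentCube v p = (3 * p ≤ᵇ length v) ∧ (length v <ᵇ 10 + 3 * p) ∧ agreeᵇ (2 * p) v (drop p v)

-- Every extension of v by d letters to the left is unbalanced, or has a cube ending
-- at one of its last 10 positions, or satisfies final.
search : (List (Fin 2) → Bool) → ℕ → List (Fin 2) → Bool
search final zero v = final v
search final (suc d) v = extend zero ∧ extend (suc zero)
  where
  extend : Fin 2 → Bool
  -- Periods 1 to 5: a cube within at most 17 letters has no longer one.
  extend a = clashWithin (a ∷ v) v ∨ any (λ p → recentCube (a ∷ v) (suc p)) (upTo 5)
             ∨ search final d (a ∷ v)

module _ {x : InfiniteWord} where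

  agreeᵇ-sound : ∀ n u v {i j} → Reads x i u → Reads x j v → T (agreeᵇ n u v) → Agree x n i j
  agreeᵇ-sound zero _ _ _ _ _ = agree λ k ()
  agreeᵇ-sound (suc n) (a ∷ u) (b ∷ v) (ea , ru) (eb , rv) h =
    let a≟b , rest = Equivalence.to T-∧ h
    in agree-cons (trans ea (trans (toWitness a≟b) (sym eb))) (agreeᵇ-sound n u v ru rv rest)

  agreeᵇ-complete : ∀ n u v {i j} → Reads x i u → Reads x j v →
    n ≤ length u → n ≤ length v → Agree x n i j → T (agreeᵇ n u v)
  agreeᵇ-complete zero _ _ _ _ _ _ _ = tt
  agreeᵇ-complete (suc n) (a ∷ u) (b ∷ v) (ea , ru) (eb , rv) n≤u n≤v e =
    Equivalence.from T-∧
      ( fromWitness (trans (sym ea) (trans (agree-head e) eb))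
      , agreeᵇ-complete n u v ru rv (s≤s⁻¹ n≤u) (s≤s⁻¹ n≤v) (agree-tail e))

  clash-sound : ∀ p q u v {i j} → Reads x i u → Reads x j v → T (clash p q u v) →
    ∃[ m ] (suc (q + count x j m) < p + count x i m ⊎ suc (p + count x i m) < q + count x j m)
  clash-sound p q (_ ∷ u) (_ ∷ v) {i} {j} (refl , ru) (refl , rv) h
    with Equivalence.to (T-∨ {suc (q + toℕ (x j)) <ᵇ p + toℕ (x i)}) h
  ... | inj₁ lt = 1 , inj₁ (subst₂ (λ a b → suc (q + a) < p + b)
                    (sym (+-identityʳ _)) (sym (+-identityʳ _)) (<ᵇ⇒< _ _ lt))
  ... | inj₂ h′ with Equivalence.to (T-∨ {suc (p + toℕ (x i)) <ᵇ q + toℕ (x j)}) h′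
  ... | inj₁ lt = 1 , inj₂ (subst₂ (λ a b → suc (p + a) < q + b)
                    (sym (+-identityʳ _)) (sym (+-identityʳ _)) (<ᵇ⇒< _ _ lt))
  ... | inj₂ h″ with clash-sound (p + toℕ (x i)) (q + toℕ (x j)) u v ru rv h″
  ... | m , inj₁ lt = suc m , inj₁ (subst₂ (λ a b → suc a < b) (+-assoc q _ _) (+-assoc p _ _) lt)
  ... | m , inj₂ lt = suc m , inj₂ (subst₂ (λ a b → suc a < b) (+-assoc p _ _) (+-assoc q _ _) lt)

  clashWithin-sound : Balanced x → ∀ u v {i j} → Reads x i u → Reads x j v →
    ¬ T (clashWithin u v)
  clashWithin-sound bal u (b ∷ v) {i} {j} ru rv h with Equivalence.to (T-∨ {clash 0 0 u (b ∷ v)}) h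
  ... | inj₂ h′ = clashWithin-sound bal u v ru (proj₂ rv) h′
  ... | inj₁ c with clash-sound 0 0 u (b ∷ v) ru rv c
  ... | m , inj₁ lt = <⇒≱ lt (bal m i j)
  ... | m , inj₂ lt = <⇒≱ lt (bal m j i)

  Reads-drop : ∀ k v {i} → Reads x i v → Reads x (i + k) (drop k v)
  Reads-drop zero v {i} r = subst (λ l → Reads x l v) (sym (+-identityʳ i)) r
  Reads-drop (suc k) [] r = tt
  Reads-drop (suc k) (_ ∷ v) {i} r =
    subst (λ l → Reads x l (drop k v)) (sym (+-suc i k)) (Reads-drop k v (proj₂ r))

  CubeWithin10 : ℕ → Set
  CubeWithin10 n = ∃[ m ] n < m × m ≤ n + 10 × CubeEndsAt x m

  recentCube-sound : ∀ v p {i n} → Reads x i v → i + length v ≡ n + 10 →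
    T (recentCube v (suc p)) → CubeWithin10 n
  recentCube-sound v p′ {i} {n} r len h =
    let h₁ , h′ = Equivalence.to (T-∧ {3 * p ≤ᵇ length v}) h
        h₂ , h₃ = Equivalence.to (T-∧ {length v <ᵇ 10 + 3 * p}) h′
    in i + 3 * p
     , +-cancelʳ-< 10 n _ (subst₂ _<_ len (trans (cong (i +_) (+-comm 10 (3 * p))) (sym (+-assoc i (3 * p) 10)))
         (+-monoʳ-< i (<ᵇ⇒< _ _ h₂)))
     , ≤-trans (+-monoʳ-≤ i (≤ᵇ⇒≤ (3 * p) _ h₁)) (≤-reflexive len)
     , cubeOfPeriod⇒cubeEndsAt p (s≤s z≤n , m≤n+m (3 * p) i ,
         subst (λ a → Agree x (2 * p) a (a + p)) (sym (m+n∸n≡m i (3 * p)))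
           (agreeᵇ-sound (2 * p) v (drop p v) r (Reads-drop p v r) h₃))
    where p = suc p′

  search-sound : Balanced x → ∀ final d v {i n} → Reads x (d + i) v → d + i + length v ≡ n + 10 →
    (∀ w → Reads x i w → i + length w ≡ n + 10 → ¬ T (final w)) →
    T (search final d v) → CubeWithin10 n
  search-sound bal final zero v r len ¬final h = contradiction h (¬final v r len)
  search-sound bal final (suc d) v {i} {n} r len ¬final h = extend (branch (x (d + i)) refl)
    where
    Extend : Fin 2 → Bool
    Extend a = clashWithin (a ∷ v) v ∨ any (λ p → recentCube (a ∷ v) (suc p)) (upTo 5)
               ∨ search final d (a ∷ v)
    branch : ∀ a → x (d + i) ≡ a → T (Extend (x (d + i)))
    branch zero eq = subst (T ∘ Extend) (sym eq) (proj₁ (Equivalence.to (T-∧ {Extend zero}) h))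
    branch (suc zero) eq = subst (T ∘ Extend) (sym eq) (proj₂ (Equivalence.to (T-∧ {Extend zero}) h))
    w = x (d + i) ∷ v
    rw : Reads x (d + i) w
    rw = refl , r
    lenw : d + i + length w ≡ n + 10
    lenw = trans (+-suc (d + i) (length v)) len
    extend : T (Extend (x (d + i))) → CubeWithin10 n
    extend e with Equivalence.to (T-∨ {clashWithin w v}) e
    ... | inj₁ c = contradiction c (clashWithin-sound bal w v rw r)
    ... | inj₂ e′ with Equivalence.to (T-∨ {any (λ p → recentCube w (suc p)) (upTo 5)}) e′
    ... | inj₁ c = let p , hp = satisfied (any⁻ (λ p → recentCube w (suc p)) (upTo 5) c) in recentCube-sound w p rw lenw hp
    ... | inj₂ s = search-sound bal final d w rw lenw ¬final s

  cubeWithin10-late : Balanced x → ∀ n → 7 ≤ n → CubeWithin10 n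
  -- The window reaches from `n ∸ 7` to `n + 10`, hence 17 letters. No leaf may survive, and the
  -- last `tt` is the evaluated search.
  cubeWithin10-late bal n 7≤n = search-sound bal (λ _ → false) 17 [] {n ∸ 7} tt
    (trans (+-identityʳ _) (trans (cong (10 +_) (m+[n∸m]≡n 7≤n)) (+-comm 10 n))) (λ _ _ _ ()) tt

  -- The leaves left over when the window is a whole prefix of x of length `n + 10`: the cube
  -- assumed to end at `n` rules them out.
  noCube : ℕ → ℕ → List (Fin 2) → Bool
  noCube n p w = not (agreeᵇ (2 * p) (drop (n ∸ 3 * p) w) (drop (n ∸ 3 * p + p) w))

  noCube-sound : ∀ {n p} → CubeOfPeriod x n p → ∀ w → Reads x 0 w → length w ≡ n + 10 →
    ¬ T (noCube n p w)
  noCube-sound {n} {p} (_ , 3p≤n , e) w r len h =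
    subst T (Equivalence.to T-not-≡ h)
      (agreeᵇ-complete (2 * p) (drop a w) (drop (a + p) w) (Reads-drop a w r) (Reads-drop (a + p) w r)
        (enough a (≤-trans (m≤m+n _ p) (≤-reflexive fits)))
        (enough (a + p) (≤-reflexive (trans (+-assoc a p _) (trans (cong (a +_) (+-comm p _))
          (trans (sym (+-assoc a _ p)) fits))))) e)
    where
    a = n ∸ 3 * p
    fits : a + 2 * p + p ≡ n
    fits = trans (+-assoc a (2 * p) p) (trans (cong (a +_) (sym (3*p≡2*p+p p))) (m∸n+n≡m 3p≤n))
    enough : ∀ b → b + 2 * p ≤ n → 2 * p ≤ length (drop b w)
    enough b h = subst (2 * p ≤_) (sym (length-drop b w))
      (m+n≤o⇒m≤o∸n (2 * p) (≤-trans (≤-reflexive (+-comm (2 * p) b))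
        (≤-trans h (subst (n ≤_) (sym len) (m≤m+n n 10)))))

  -- A cube ending at n < 7 has period 1 or 2.
  early-search : ∀ {n} → n < 7 → ∀ {p} → p < 2 → T (search (noCube n (suc p)) (n + 10) [])
  early-search = from-yes (allUpTo? (λ n → allUpTo? (λ p → T? (search (noCube n (suc p)) (n + 10) [])) 2) 7)

  cubeWithin10-early : Balanced x → ∀ n → n < 7 → ∀ p → CubeOfPeriod x n p → CubeWithin10 n
  cubeWithin10-early bal n n<7 (suc p) c@(_ , 3p≤n , _) =
    search-sound bal (noCube n (suc p)) (n + 10) [] {0} tt
      (trans (+-identityʳ _) (+-identityʳ _))
      (noCube-sound c)
      (early-search n<7 (s<s⁻¹ (*-cancelˡ-< 3 (suc p) 3 (≤-<-trans 3p≤n (<-≤-trans n<7 (m≤n+m 7 2))))))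

  cubeWithin10 : Balanced x → ∀ n → CubeEndsAt x n → CubeWithin10 n
  cubeWithin10 bal n c with 7 ≤? n
  ... | yes 7≤n = cubeWithin10-late bal n 7≤n
  ... | no n≱7 = let p , c′ = cubeEndsAt⇒cubeOfPeriod {x} c in cubeWithin10-early bal n (≰⇒> n≱7) p c′

maxCubeGapAtMost10 : ∀ {x} → Sturmian x → MaxCubeGapAtMost x 10
maxCubeGapAtMost10 {x} st = list , lists , gap≤
  where
  bal = sturmian⇒balanced st
  -- From 7 on no previous cube is assumed, so the list can be started there.
  someCube : ∃[ n ] CubeEndsAt x n
  someCube = let m , _ , _ , c = cubeWithin10-late {x} bal 7 ≤-refl in m , c
  list = Enumeration.list (cubeEndsAt? x) 10 someCube (cubeWithin10 {x} bal)
  lists = Enumeration.lists (cubeEndsAt? x) 10 someCube (cubeWithin10 {x} bal)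
  gap≤ = Enumeration.gap≤ (cubeEndsAt? x) 10 someCube (cubeWithin10 {x} bal)

-- Sturmian words from balance and left special prefixes

count-agree : ∀ {x n i j} → Agree x n i j → count x i n ≡ count x j n
count-agree {n = zero} e = refl
count-agree {n = suc n} e = cong₂ _+_ (cong toℕ (agree-head e)) (count-agree (agree-tail e))

-- The left special factors are exactly the prefixes of x, so passing to length
-- n + 1 every class gets one left extension except the class of the prefix.
module LeftSpecialPrefixes {x : InfiniteWord} (balanced : Balanced x)
  (extend : ∀ n a → ∃[ q ] x q ≡ a × Agree x n (suc q) 0) where

  -- The words a w a and b w b differ by two in their number of ones.
  enclosed⇒⊥ : ∀ {k u v a b} → x u ≡ a → x v ≡ b → a ≢ b → Agree x k (suc u) (suc v) →
    x (suc u + k) ≡ a → x (suc v + k) ≡ b → ⊥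
  enclosed⇒⊥ {a = zero} {zero} _ _ a≢b _ _ _ = a≢b refl
  enclosed⇒⊥ {a = suc zero} {suc zero} _ _ a≢b _ _ _ = a≢b refl
  enclosed⇒⊥ {a = suc zero} {zero} xu xv a≢b e xu′ xv′ =
    enclosed⇒⊥ xv xu (a≢b ∘ sym) (agree-sym e) xv′ xu′
  enclosed⇒⊥ {k} {u} {v} {zero} {suc zero} xu xv _ e xu′ xv′ = <⇒≱ (begin-strict
    suc (count x u (2 + k))        ≡⟨ cong suc (ends u xu xu′) ⟩
    suc (count x (suc u) k + 0)    ≡⟨ cong suc (trans (+-identityʳ _) (count-agree e)) ⟩
    suc (count x (suc v) k)        <⟨ s<s (≤-reflexive (+-comm 1 _)) ⟩
    suc (count x (suc v) k + 1)    ≡⟨ sym (ends v xv xv′) ⟩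
    count x v (2 + k)              ∎) (balanced (2 + k) v u)
    where
    open ≤-Reasoning
    ends : ∀ w {a} → x w ≡ a → x (suc w + k) ≡ a →
      count x w (2 + k) ≡ toℕ a + (count x (suc w) k + toℕ a)
    ends w refl xw′ = cong (toℕ (x w) +_)
      (trans (count-suc x (suc w) k) (cong (λ b → count x (suc w) k + toℕ b) xw′))

  -- Suppose a left special word w c departs from the prefixes of x, where w is followed by d. One
  -- of its two left letters is c, so c w c occurs, while `extend` supplies d w d.
  leftSpecial⇒prefix : ∀ n {u v} → x u ≢ x v → Agree x n (suc u) (suc v) → Agree x n (suc u) 0
  leftSpecial⇒prefix zero _ _ = agree λ k ()
  leftSpecial⇒prefix (suc k) {u} {v} u≢v e with leftSpecial⇒prefix k u≢v (agree-init e)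
  ... | prefix with x (suc u + k) ≟ x k
  ... | yes eq = agree-snoc prefix eq
  ... | no ne with extend (suc k) (x k) | x u ≟ x (suc u + k)
  ... | q , xq , eq | yes xu = ⊥-elim (enclosed⇒⊥ xu xq ne
          (agree-trans prefix (agree-sym (agree-init eq))) refl (agree-last eq))
  ... | q , xq , eq | no xu = ⊥-elim (enclosed⇒⊥ (sym (binary (xu ∘ sym) (u≢v ∘ sym))) xq ne
          (agree-trans (agree-sym (agree-init e)) (agree-trans prefix (agree-sym (agree-init eq))))
          (sym (agree-last e)) (agree-last eq))

  other : Fin 2 → Fin 2
  other zero = suc zero
  other (suc zero) = zero

  other≢ : ∀ a → other a ≢ a
  other≢ zero ()
  other≢ (suc zero) ()

  representatives : ∀ n → Representatives x n
  representatives zero = (λ _ → 0) , (λ { zero zero _ → refl }) , λ i → zero , agree λ k ()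
  representatives (suc n) with representatives n
  ... | r , distinct , cover = r′ , distinct′ , cover′
    where
    predecessor : ∀ i → ∃[ e ] Agree x n (suc e) i
    predecessor (suc i) = i , agree-refl
    -- Nothing precedes position 0, so another occurrence of the prefix stands in for it.
    predecessor zero = let q , _ , e = extend n zero in q , e

    left : ∀ t → ℕ
    left t = proj₁ (predecessor (r t))
    left-agree : ∀ t → Agree x n (suc (left t)) (r t)
    left-agree t = proj₂ (predecessor (r t))

    t₀ = proj₁ (cover 0)
    prefix≡t₀ : ∀ t → Agree x n (r t) 0 → t ≡ t₀
    prefix≡t₀ t e = distinct t t₀ (agree-trans e (proj₂ (cover 0)))

    second = extend n (other (x (left t₀)))
    q = proj₁ second
    q-prefix : Agree x n (suc q) 0
    q-prefix = proj₂ (proj₂ second)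
    q≢ : x q ≢ x (left t₀)
    q≢ eq = other≢ _ (trans (sym (proj₁ (proj₂ second))) eq)

    r′ : Fin (2 + n) → ℕ
    r′ zero = q
    r′ (suc t) = left t

    q≁left : ∀ t → ¬ Agree x (suc n) q (left t)
    q≁left t e with prefix≡t₀ t (agree-trans (agree-sym (left-agree t))
                     (agree-trans (agree-sym (agree-tail e)) q-prefix))
    ... | refl = q≢ (agree-head e)

    distinct′ : ∀ s t → Agree x (suc n) (r′ s) (r′ t) → s ≡ t
    distinct′ zero zero e = refl
    distinct′ zero (suc t) e = contradiction e (q≁left t)
    distinct′ (suc s) zero e = contradiction (agree-sym e) (q≁left s)
    distinct′ (suc s) (suc t) e = cong suc (distinct s t
      (agree-trans (agree-sym (left-agree s)) (agree-trans (agree-tail e) (left-agree t))))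

    cover′ : ∀ i → ∃[ t ] Agree x (suc n) i (r′ t)
    cover′ i with cover (suc i)
    ... | t , e with x i ≟ x (left t)
    ... | yes eq = suc t , agree-cons eq (agree-trans e (agree-sym (left-agree t)))
    ... | no ne with leftSpecial⇒prefix n ne (agree-trans e (agree-sym (left-agree t)))
    ... | prefix with prefix≡t₀ t (agree-trans (agree-sym e) prefix)
    ... | refl = zero , agree-cons (binary ne q≢) (agree-trans prefix (agree-sym q-prefix))

-- The word of slope √2 - 1 and its balance

square-mono-≤ : ∀ {m n} → m ≤ n → m * m ≤ n * n
square-mono-≤ m≤n = *-mono-≤ m≤n m≤n

square-cancel-< : ∀ {m n} → m * m < n * n → m < n
square-cancel-< h = ≰⇒> λ n≤m → <⇒≱ h (square-mono-≤ n≤m)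

square-cancel-≤ : ∀ {m n} → m * m ≤ n * n → m ≤ n
square-cancel-≤ h = ≮⇒≥ λ n<m → <⇒≱ (*-mono-< n<m n<m) h

even-square : ∀ m k → m * m ≡ 2 * k → ∃[ l ] m ≡ 2 * l
even-square m k eq with euclidsLemma m m prime[2] (divides k (trans eq (*-comm 2 k)))
... | inj₁ (divides l m≡) = l , trans m≡ (*-comm l 2)
... | inj₂ (divides l m≡) = l , trans m≡ (*-comm l 2)

√2-irrational : ∀ n m → 1 ≤ n → m * m ≢ 2 * (n * n)
√2-irrational = <-rec _ step
  where
  halve : ∀ {l k} → 2 * l * (2 * l) ≡ 2 * k → 2 * (l * l) ≡ k
  halve {l} {k} eq = *-cancelˡ-≡ _ _ 2 (trans (square l) eq)
    where
    square : ∀ l → 2 * (2 * (l * l)) ≡ 2 * l * (2 * l)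
    square = solve-∀
  step : ∀ n → (∀ {k} → k < n → ∀ m → 1 ≤ k → m * m ≢ 2 * (k * k)) →
         ∀ m → 1 ≤ n → m * m ≢ 2 * (n * n)
  step n smaller m 1≤n eq with even-square m (n * n) eq
  ... | l , refl with halve {l} eq
  ... | eq′ with even-square n (l * l) (sym eq′)
  ... | suc k , refl = smaller (m<m+n (suc k) z<s) l z<s (sym (halve {suc k} (sym eq′)))

-- For s = ⌊ n √2 ⌋ this is ⌊ (n + 1) √2 ⌋ - s, which is 1 or 2, coded as 0 or 1.
increment : ℕ → ℕ → Fin 2
increment n s = if (2 + s) * (2 + s) ≤ᵇ 2 * (suc n * suc n) then suc zero else zero

⌊_√2⌋ : ℕ → ℕ
⌊ zero √2⌋ = 0
⌊ suc n √2⌋ = next ⌊ n √2⌋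
  where
  next : ℕ → ℕ
  next s = suc (toℕ (increment n s)) + s

-- The differences are taken from n = 1 on, not from 0, which gives the characteristic word: the
-- floor at 0 does not obey the shift in `floor-shift-plus`.
√2-word : InfiniteWord
√2-word i = increment (suc i) ⌊ suc i √2⌋

n≤⌊n√2⌋ : ∀ n → n ≤ ⌊ n √2⌋
n≤⌊n√2⌋ zero = z≤n
n≤⌊n√2⌋ (suc n) = s≤s (≤-trans (n≤⌊n√2⌋ n) (m≤n+m _ (toℕ (increment n ⌊ n √2⌋))))

⌊n√2⌋≤2n : ∀ n → ⌊ n √2⌋ ≤ 2 * n
⌊n√2⌋≤2n zero = z≤n
⌊n√2⌋≤2n (suc n) = ≤-trans (+-mono-≤ (toℕ<n (increment n ⌊ n √2⌋)) (⌊n√2⌋≤2n n)) (≤-reflexive (sym (*-suc 2 n)))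

-- The test in `increment` settles one of the two bounds; for the other, the crude estimates n ≤
-- ⌊n√2⌋ ≤ 2n suffice.
floor-bounds : ∀ n → ⌊ n √2⌋ * ⌊ n √2⌋ ≤ 2 * (n * n) × 2 * (n * n) < suc ⌊ n √2⌋ * suc ⌊ n √2⌋
floor-bounds zero = z≤n , z<s
floor-bounds (suc n) with floor-bounds n | (2 + ⌊ n √2⌋) * (2 + ⌊ n √2⌋) ≤ᵇ 2 * (suc n * suc n) in eq
... | lo , hi | true = ≤ᵇ⇒≤ _ _ (subst T (sym eq) tt) , (begin-strict
  2 * (suc n * suc n)              ≡⟨ expand n ⟩
  2 * (n * n) + (4 * n + 2)        <⟨ +-mono-<-≤ hi (+-mono-≤ (*-monoʳ-≤ 4 (n≤⌊n√2⌋ n)) (s≤s (s≤s z≤n))) ⟩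
  suc s * suc s + (4 * s + 8)      ≡⟨ collect s ⟩
  (3 + s) * (3 + s)                ∎)
  where
  open ≤-Reasoning
  s = ⌊ n √2⌋
  expand : ∀ n → 2 * (suc n * suc n) ≡ 2 * (n * n) + (4 * n + 2)
  expand = solve-∀
  collect : ∀ s → suc s * suc s + (4 * s + 8) ≡ (3 + s) * (3 + s)
  collect = solve-∀
... | lo , hi | false = (begin
  suc s * suc s                    ≡⟨ expand s ⟩
  s * s + (2 * s + 1)              ≤⟨ +-mono-≤ lo (+-mono-≤ (*-monoʳ-≤ 2 (⌊n√2⌋≤2n n)) (s≤s z≤n)) ⟩
  2 * (n * n) + (2 * (2 * n) + 2)  ≡⟨ collect n ⟩
  2 * (suc n * suc n)              ∎) , ≰⇒> λ h → subst T eq (≤⇒≤ᵇ h)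
  where
  open ≤-Reasoning
  s = ⌊ n √2⌋
  expand : ∀ s → suc s * suc s ≡ s * s + (2 * s + 1)
  expand = solve-∀
  collect : ∀ n → 2 * (n * n) + (2 * (2 * n) + 2) ≡ 2 * (suc n * suc n)
  collect = solve-∀

floor-greatest : ∀ {k n} → k * k ≤ 2 * (n * n) → k ≤ ⌊ n √2⌋
floor-greatest {k} {n} h = s≤s⁻¹ (square-cancel-< (≤-<-trans h (proj₂ (floor-bounds n))))

floor-least : ∀ {k n} → 2 * (n * n) < k * k → ⌊ n √2⌋ < k
floor-least {k} {n} h = square-cancel-< (≤-<-trans (proj₁ (floor-bounds n)) h)

square-+ : ∀ a b → (a + b) * (a + b) ≡ a * a + b * b + 2 * (a * b)
square-+ = solve-∀

double-square-+ : ∀ a b → 2 * ((a + b) * (a + b)) ≡ 2 * (a * a) + 2 * (b * b) + 2 * (2 * (a * b))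
double-square-+ = solve-∀

square-* : ∀ a b → (a * b) * (a * b) ≡ (a * a) * (b * b)
square-* = solve-∀

double-square-* : ∀ a b → (2 * (a * b)) * (2 * (a * b)) ≡ (2 * (a * a)) * (2 * (b * b))
double-square-* = solve-∀

-- This adds s ≤ a√2 and u ≤ b√2 with √2 eliminated. The cross terms require su ≤ 2ab, which after
-- squaring is the product of the hypotheses.
below-√2-+ : ∀ {s a u b} → s * s ≤ 2 * (a * a) → u * u ≤ 2 * (b * b) →
  (s + u) * (s + u) ≤ 2 * ((a + b) * (a + b))
below-√2-+ {s} {a} {u} {b} h k = subst₂ _≤_ (sym (square-+ s u)) (sym (double-square-+ a b))
  (+-mono-≤ (+-mono-≤ h k) (*-monoʳ-≤ 2 (square-cancel-≤ {s * u} {2 * (a * b)}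
    (subst₂ _≤_ (sym (square-* s u)) (sym (double-square-* a b)) (*-mono-≤ h k)))))

above-√2-+ : ∀ {s a u b} → 2 * (a * a) < s * s → 2 * (b * b) < u * u →
  2 * ((a + b) * (a + b)) < (s + u) * (s + u)
above-√2-+ {s} {a} {u} {b} h k = subst₂ _<_ (sym (double-square-+ a b)) (sym (square-+ s u))
  (+-mono-<-≤ (+-mono-< h k) (*-monoʳ-≤ 2 (<⇒≤ (square-cancel-< {2 * (a * b)} {s * u}
    (subst₂ _<_ (sym (double-square-* a b)) (sym (square-* s u)) (*-mono-< h k))))))

floor-superadditive : ∀ a b → ⌊ a √2⌋ + ⌊ b √2⌋ ≤ ⌊ a + b √2⌋
floor-superadditive a b =
  floor-greatest {n = a + b} (below-√2-+ {⌊ a √2⌋} {a} {⌊ b √2⌋} {b} (proj₁ (floor-bounds a)) (proj₁ (floor-bounds b)))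

floor-subadditive : ∀ a b → ⌊ a + b √2⌋ ≤ suc (⌊ a √2⌋ + ⌊ b √2⌋)
floor-subadditive a b = s≤s⁻¹ (subst (⌊ a + b √2⌋ <_) (cong suc (+-suc _ _))
  (floor-least {suc ⌊ a √2⌋ + suc ⌊ b √2⌋} {a + b}
    (above-√2-+ {suc ⌊ a √2⌋} {a} {suc ⌊ b √2⌋} {b} (proj₂ (floor-bounds a)) (proj₂ (floor-bounds b)))))

-- A telescoping sum; `n` appears because a letter is the increment of the floor less one.
count-√2 : ∀ i n → count √2-word i n + n + ⌊ suc i √2⌋ ≡ ⌊ suc i + n √2⌋
count-√2 i zero = cong ⌊_√2⌋ (sym (+-identityʳ (suc i)))
count-√2 i (suc n) = begin
  toℕ a + count √2-word (suc i) n + suc n + ⌊ suc i √2⌋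
    ≡⟨ rearrange (toℕ a) (count √2-word (suc i) n) n ⌊ suc i √2⌋ ⟩
  count √2-word (suc i) n + n + ⌊ 2 + i √2⌋
    ≡⟨ count-√2 (suc i) n ⟩
  ⌊ 2 + i + n √2⌋
    ≡⟨ cong ⌊_√2⌋ (sym (+-suc (suc i) n)) ⟩
  ⌊ suc i + suc n √2⌋ ∎
  where
  open ≡-Reasoning
  a = √2-word i
  rearrange : ∀ a c n s → a + c + suc n + s ≡ c + n + (suc a + s)
  rearrange = solve-∀

-- Wherever a block of length n begins, its count plus n is ⌊n√2⌋ or one more.
√2-word-balanced : Balanced √2-word
√2-word-balanced n i j = +-cancelʳ-≤ n _ _ (≤-trans upper (s≤s lower))
  where
  upper : count √2-word i n + n ≤ suc ⌊ n √2⌋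
  upper = +-cancelʳ-≤ ⌊ suc i √2⌋ _ _ (≤-trans (≤-reflexive (count-√2 i n))
    (≤-trans (floor-subadditive (suc i) n) (≤-reflexive (cong suc (+-comm ⌊ suc i √2⌋ _)))))
  lower : ⌊ n √2⌋ ≤ count √2-word j n + n
  lower = +-cancelʳ-≤ ⌊ suc j √2⌋ _ _ (≤-trans (≤-reflexive (+-comm ⌊ n √2⌋ _))
    (≤-trans (floor-superadditive (suc j) n) (≤-reflexive (sym (count-√2 j n)))))

-- Pell approximations and the letters before prefixes

-- The step multiplies p + q√2 by 1 + √2, whose norm is -1.
pell-step-plus : ∀ {p q} → suc (p * p) ≡ 2 * (q * q) →
  (p + 2 * q) * (p + 2 * q) ≡ suc (2 * ((p + q) * (p + q)))
pell-step-plus {p} {q} eq = +-cancelˡ-≡ (suc (p * p)) _ _ (begin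
  suc (p * p) + (p + 2 * q) * (p + 2 * q)                ≡⟨ expand p q ⟩
  2 * (q * q) + suc (2 * ((p + q) * (p + q)))            ≡⟨ cong (_+ suc (2 * ((p + q) * (p + q)))) (sym eq) ⟩
  suc (p * p) + suc (2 * ((p + q) * (p + q)))            ∎)
  where
  open ≡-Reasoning
  expand : ∀ p q → suc (p * p) + (p + 2 * q) * (p + 2 * q) ≡ 2 * (q * q) + suc (2 * ((p + q) * (p + q)))
  expand = solve-∀

pell-step-minus : ∀ {p q} → p * p ≡ suc (2 * (q * q)) →
  suc ((p + 2 * q) * (p + 2 * q)) ≡ 2 * ((p + q) * (p + q))
pell-step-minus {p} {q} eq = +-cancelˡ-≡ (p * p) _ _ (begin
  p * p + suc ((p + 2 * q) * (p + 2 * q))          ≡⟨ expand p q ⟩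
  suc (2 * (q * q)) + 2 * ((p + q) * (p + q))      ≡⟨ cong (_+ 2 * ((p + q) * (p + q))) (sym eq) ⟩
  p * p + 2 * ((p + q) * (p + q))                  ∎)
  where
  open ≡-Reasoning
  expand : ∀ p q → p * p + suc ((p + 2 * q) * (p + 2 * q)) ≡ suc (2 * (q * q)) + 2 * ((p + q) * (p + q))
  expand = solve-∀

-- Named after the sign of p² - 2q²: the fraction p / q lies below √2 for `PellMinus` and above it
-- for `PellPlus`.
PellMinus PellPlus : ℕ → Set
PellMinus n = ∃[ p ] ∃[ q ] 1 ≤ p × n < q × suc (p * p) ≡ 2 * (q * q)
PellPlus n = ∃[ p ] ∃[ q ] 1 ≤ p × n < q × p * p ≡ suc (2 * (q * q))

pellMinus⇒pellPlus : ∀ {n} → PellMinus n → PellPlus (suc n)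
pellMinus⇒pellPlus (p , q , 1≤p , n<q , eq) =
  p + 2 * q , p + q , ≤-trans 1≤p (m≤m+n p _) , +-mono-≤ 1≤p n<q , pell-step-plus {p} {q} eq

pellPlus⇒pellMinus : ∀ {n} → PellPlus n → PellMinus (suc n)
pellPlus⇒pellMinus (p , q , 1≤p , n<q , eq) =
  p + 2 * q , p + q , ≤-trans 1≤p (m≤m+n p _) , +-mono-≤ 1≤p n<q , pell-step-minus {p} {q} eq

pellMinus : ∀ n → PellMinus n
pellMinus zero = 1 , 1 , ≤-refl , ≤-refl , refl
pellMinus (suc n) =
  let p , q , 1≤p , n<q , eq = pellPlus⇒pellMinus (pellMinus⇒pellPlus (pellMinus n))
  in p , q , 1≤p , <-trans (n<1+n _) n<q , eq

pellPlus : ∀ n → PellPlus n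
pellPlus n =
  let p , q , 1≤p , n<q , eq = pellMinus⇒pellPlus (pellMinus n)
  in p , q , 1≤p , <-trans (n<1+n _) n<q , eq

-- The excess of q√2 over p is too small to carry i√2 past an integer when i < q. In squares, the
-- surplus 1 of 2q² over p² is absorbed by 2i² < u²; the cross term needs 2i² < p², which is where i
-- < q enters.
floor-shift-minus : ∀ {p q i} → suc (p * p) ≡ 2 * (q * q) → i < q →
  ⌊ q + i √2⌋ ≡ p + ⌊ i √2⌋
floor-shift-minus {p} {q} {i} eq i<q = ≤-antisym
  (s≤s⁻¹ (subst (⌊ q + i √2⌋ <_) (+-suc p s) (floor-least {p + u} {q + i} above)))
  (floor-greatest {n = q + i} (below-√2-+ {p} {q} {s} {i}
    (≤-trans (n≤1+n _) (≤-reflexive eq)) (proj₁ (floor-bounds i))))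
  where
  open ≤-Reasoning
  s = ⌊ i √2⌋
  u = suc s
  2i²<u² = proj₂ (floor-bounds i)

  rearrange : ∀ a i → 2 * (i * i) * suc a ≡ 2 * (i * i) * a + 2 * (i * i)
  rearrange = solve-∀
  2i²<p² : 2 * (i * i) < p * p
  2i²<p² = s≤s⁻¹ (begin
    2 + 2 * (i * i)    ≤⟨ m≤m+n _ (4 * i) ⟩
    2 + 2 * (i * i) + 4 * i ≡⟨ expand i ⟩
    2 * (suc i * suc i) ≤⟨ *-monoʳ-≤ 2 (square-mono-≤ i<q) ⟩
    2 * (q * q)         ≡⟨ sym eq ⟩
    suc (p * p)         ∎)
    where
    expand : ∀ i → 2 + 2 * (i * i) + 4 * i ≡ 2 * (suc i * suc i)
    expand = solve-∀
  cross : 2 * (q * i) < p * u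
  cross = square-cancel-< (begin-strict
    2 * (q * i) * (2 * (q * i))            ≡⟨ double-square-* q i ⟩
    2 * (q * q) * (2 * (i * i))            ≡⟨ cong (_* (2 * (i * i))) (sym eq) ⟩
    suc (p * p) * (2 * (i * i))            ≡⟨⟩
    2 * (i * i) + p * p * (2 * (i * i))    <⟨ +-monoˡ-< _ 2i²<p² ⟩
    p * p + p * p * (2 * (i * i))          ≡⟨ sym (*-suc (p * p) _) ⟩
    p * p * suc (2 * (i * i))              ≤⟨ *-monoʳ-≤ (p * p) 2i²<u² ⟩
    p * p * (u * u)                        ≡⟨ sym (square-* p u) ⟩
    p * u * (p * u)                        ∎)
  above : 2 * ((q + i) * (q + i)) < (p + u) * (p + u)
  above = begin-strict
    2 * ((q + i) * (q + i))                                 ≡⟨ double-square-+ q i ⟩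
    2 * (q * q) + 2 * (i * i) + 2 * (2 * (q * i))           ≡⟨ cong (λ a → a + 2 * (i * i) + 2 * (2 * (q * i))) (sym eq) ⟩
    suc (p * p) + 2 * (i * i) + 2 * (2 * (q * i))           ≡⟨ cong (_+ 2 * (2 * (q * i))) (sym (+-suc (p * p) _)) ⟩
    p * p + suc (2 * (i * i)) + 2 * (2 * (q * i))           <⟨ +-mono-≤-< (+-monoʳ-≤ (p * p) 2i²<u²) (*-monoʳ-< 2 cross) ⟩
    p * p + u * u + 2 * (p * u)                             ≡⟨ sym (square-+ p u) ⟩
    (p + u) * (p + u)                                       ∎

-- Now q√2 falls short of p, so i√2 must lie strictly above its floor: irrationality gives this for
-- i ≥ 1. At i = 0 the floor is p - 1, and this defect produces the letter 1 in `one-before-prefix`.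
floor-shift-plus : ∀ {p q i} → p * p ≡ suc (2 * (q * q)) → 1 ≤ i → i < q →
  ⌊ q + i √2⌋ ≡ p + ⌊ i √2⌋
floor-shift-plus {p} {q} {i} eq 1≤i i<q = ≤-antisym
  (s≤s⁻¹ (subst (⌊ q + i √2⌋ <_) (+-suc p s) (floor-least {p + suc s} {q + i}
    (above-√2-+ {p} {q} {suc s} {i} (≤-reflexive (sym eq)) (proj₂ (floor-bounds i))))))
  (floor-greatest {n = q + i} below)
  where
  open ≤-Reasoning
  s = ⌊ i √2⌋
  s²<2i² : s * s < 2 * (i * i)
  s²<2i² = ≤∧≢⇒< (proj₁ (floor-bounds i)) (√2-irrational i s 1≤i)
  cross : p * s ≤ 2 * (q * i)
  cross = square-cancel-≤ (+-cancelʳ-≤ (p * p) _ _ (begin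
    p * s * (p * s) + p * p                        ≡⟨ cong (_+ p * p) (square-* p s) ⟩
    p * p * (s * s) + p * p                        ≡⟨ +-comm (p * p * (s * s)) (p * p) ⟩
    p * p + p * p * (s * s)                        ≡⟨ sym (*-suc (p * p) (s * s)) ⟩
    p * p * suc (s * s)                            ≤⟨ *-monoʳ-≤ (p * p) s²<2i² ⟩
    p * p * (2 * (i * i))                          ≡⟨ cong (_* (2 * (i * i))) eq ⟩
    2 * (i * i) + 2 * (q * q) * (2 * (i * i))      ≡⟨ cong (2 * (i * i) +_) (sym (double-square-* q i)) ⟩
    2 * (i * i) + 2 * (q * i) * (2 * (q * i))      ≡⟨ +-comm (2 * (i * i)) _ ⟩
    2 * (q * i) * (2 * (q * i)) + 2 * (i * i)      ≤⟨ +-monoʳ-≤ (2 * (q * i) * (2 * (q * i)))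
                                                        (≤-trans (*-monoʳ-≤ 2 (square-mono-≤ (<⇒≤ i<q)))
                                                          (≤-trans (n≤1+n _) (≤-reflexive (sym eq)))) ⟩
    2 * (q * i) * (2 * (q * i)) + p * p            ∎))
  below : (p + s) * (p + s) ≤ 2 * ((q + i) * (q + i))
  below = begin
    (p + s) * (p + s)                               ≡⟨ square-+ p s ⟩
    p * p + s * s + 2 * (p * s)                     ≡⟨ cong (λ a → a + s * s + 2 * (p * s)) eq ⟩
    suc (2 * (q * q) + s * s) + 2 * (p * s)         ≡⟨ cong (_+ 2 * (p * s)) (sym (+-suc (2 * (q * q)) (s * s))) ⟩
    2 * (q * q) + suc (s * s) + 2 * (p * s)         ≤⟨ +-mono-≤ (+-monoʳ-≤ (2 * (q * q)) s²<2i²) (*-monoʳ-≤ 2 cross) ⟩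
    2 * (q * q) + 2 * (i * i) + 2 * (2 * (q * i))   ≡⟨ sym (double-square-+ q i) ⟩
    2 * ((q + i) * (q + i))                         ∎

-- Letter k involves the floors at k + 1 and k + 2, hence the range of i, which avoids 0.
√2-word-shift : ∀ {p q n} → (∀ {i} → 1 ≤ i → i < 2 + n → ⌊ q + i √2⌋ ≡ p + ⌊ i √2⌋) →
  Agree √2-word n q 0
√2-word-shift {p} {q} {n} shift = agree λ k k<n → toℕ-injective (suc-injective
  (+-cancelʳ-≡ (p + ⌊ suc k √2⌋) _ _ (begin
    suc (toℕ (√2-word (q + k))) + (p + ⌊ suc k √2⌋)
      ≡⟨ cong (suc (toℕ (√2-word (q + k))) +_) (sym (shift (s≤s z≤n) (s<s (m<n⇒m<1+n k<n)))) ⟩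
    suc (toℕ (√2-word (q + k))) + ⌊ q + suc k √2⌋
      ≡⟨ cong (λ l → suc (toℕ (√2-word (q + k))) + ⌊ l √2⌋) (+-suc q k) ⟩
    ⌊ 2 + (q + k) √2⌋
      ≡⟨ cong ⌊_√2⌋ (sym (trans (+-suc q (suc k)) (cong suc (+-suc q k)))) ⟩
    ⌊ q + (2 + k) √2⌋
      ≡⟨ shift (s≤s z≤n) (s<s (s<s k<n)) ⟩
    p + (suc (toℕ (√2-word k)) + ⌊ suc k √2⌋)
      ≡⟨ rearrange p (suc (toℕ (√2-word k))) ⌊ suc k √2⌋ ⟩
    suc (toℕ (√2-word k)) + (p + ⌊ suc k √2⌋) ∎)))
  where
  open ≡-Reasoning
  rearrange : ∀ a b c → a + (b + c) ≡ b + (a + c)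
  rearrange = solve-∀

-- The hypothesis is the shift at i = 1, as ⌊√2⌋ = 1. The letter is then 0 or 1 according to whether
-- (q + 1)√2 lies above or below p.
letter-before : ∀ {p q} → ⌊ suc q + 1 √2⌋ ≡ p + 1 → toℕ (√2-word q) + ⌊ suc q √2⌋ ≡ p
letter-before {p} {q} eq = suc-injective (begin
  ⌊ 2 + q √2⌋      ≡⟨ cong ⌊_√2⌋ (+-comm 1 (suc q)) ⟩
  ⌊ suc q + 1 √2⌋  ≡⟨ eq ⟩
  p + 1            ≡⟨ +-comm p 1 ⟩
  suc p            ∎)
  where open ≡-Reasoning

zero-before-prefix : ∀ {n} p q → suc (p * p) ≡ 2 * (suc q * suc q) → 2 + n < suc q →
  √2-word q ≡ zero × Agree √2-word n (suc q) 0
zero-before-prefix {n} p q eq n<q =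
  toℕ-injective (n≤0⇒n≡0 (+-cancelʳ-≤ p a 0 a+p≤p)) , √2-word-shift {p} {suc q} (λ {i} _ → shift i)
  where
  a = toℕ (√2-word q)
  shift : ∀ i → i < 2 + n → ⌊ suc q + i √2⌋ ≡ p + ⌊ i √2⌋
  shift i i< = floor-shift-minus {p} {suc q} {i} eq (<-trans i< n<q)
  a+p≤p : a + p ≤ p
  a+p≤p = ≤-trans
    (+-monoʳ-≤ a (floor-greatest {p} {suc q} (≤-trans (n≤1+n _) (≤-reflexive eq))))
    (≤-reflexive (letter-before {p} {q} (shift 1 (s≤s (s≤s z≤n)))))

one-before-prefix : ∀ {n} p q → p * p ≡ suc (2 * (suc q * suc q)) → 2 + n < suc q →
  √2-word q ≡ suc zero × Agree √2-word n (suc q) 0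
one-before-prefix {n} p q eq n<q =
  one (√2-word q) (+-cancelʳ-≤ ⌊ suc q √2⌋ 1 a p≤a+⌊q√2⌋) , √2-word-shift {p} {suc q} (λ {i} → shift i)
  where
  a = toℕ (√2-word q)
  shift : ∀ i → 1 ≤ i → i < 2 + n → ⌊ suc q + i √2⌋ ≡ p + ⌊ i √2⌋
  shift i 1≤i i< = floor-shift-plus {p} {suc q} {i} eq 1≤i (<-trans i< n<q)
  p≤a+⌊q√2⌋ : suc ⌊ suc q √2⌋ ≤ a + ⌊ suc q √2⌋
  p≤a+⌊q√2⌋ = ≤-trans (floor-least {p} {suc q} (≤-reflexive (sym eq)))
    (≤-reflexive (sym (letter-before {p} {q} (shift 1 ≤-refl (s≤s (s≤s z≤n))))))
  one : ∀ a → 1 ≤ toℕ a → a ≡ suc zero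
  one (suc zero) _ = refl

√2-word-leftSpecial : ∀ n a → ∃[ q ] √2-word q ≡ a × Agree √2-word n (suc q) 0
√2-word-leftSpecial n zero = before (pellMinus (2 + n))
  where
  before : PellMinus (2 + n) → ∃[ q ] √2-word q ≡ zero × Agree √2-word n (suc q) 0
  before (p , suc q , _ , n<q , eq) = q , zero-before-prefix p q eq n<q
√2-word-leftSpecial n (suc zero) = before (pellPlus (2 + n))
  where
  before : PellPlus (2 + n) → ∃[ q ] √2-word q ≡ suc zero × Agree √2-word n (suc q) 0
  before (p , suc q , _ , n<q , eq) = q , one-before-prefix p q eq n<q

-- A gap of exactly 10

√2-word-sturmian : Sturmian √2-word
√2-word-sturmian = representatives⇒sturmian
  (LeftSpecialPrefixes.representatives √2-word-balanced √2-word-leftSpecial)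

-- Only the cube ending at 17 and the absence of cubes ending at 18 to 26 are computed; the general
-- bound then forces the next end to be 27.
√2-word-gap : MaxCubeGapIs √2-word 10
√2-word-gap = attained (maxCubeGapAtMost10 {√2-word} √2-word-sturmian)
  where
  check : ∀ {d} → d < 9 → ¬ CubeEndsAt √2-word (18 + d)
  check = from-yes (allUpTo? (λ d → ¬? (cubeEndsAt? √2-word (18 + d))) 9)
  none : ∀ k → 17 < k → k < 17 + 10 → ¬ CubeEndsAt √2-word k
  none k 17<k k<27 = subst (λ l → ¬ CubeEndsAt √2-word l) (m+[n∸m]≡n 17<k)
    (check (∸-monoˡ-< k<27 17<k))
  attained : MaxCubeGapAtMost √2-word 10 → MaxCubeGapIs √2-word 10
  attained (p , lists , gap≤) = p , lists , gap≤ ,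
    Enumeration.gap-attained (cubeEndsAt? √2-word) lists gap≤ 17
      (from-yes (cubeEndsAt? √2-word 17)) none

theorem1 : (∀ x → Sturmian x → MaxCubeGapAtMost x 10)
    × (∃[ x ] Sturmian x × MaxCubeGapIs x 10)
theorem1 = (λ x → maxCubeGapAtMost10 {x}) , √2-word , √2-word-sturmian , √2-word-gap
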